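{- For all integers $2 \le i \le j \le n$, the group homomorphism $J_n^{i,j} \to J_n$ defined on generators by $s_{p,q} \mapsto s_{p,q}$ is injective.
   Context: For $n \ge 2$, the cactus group $J_n$ is the group with generators $s_{p,q}$ for $1 \le p < q \le n$ and relations: (j1) $s_{p,q}^2 = 1$; (j2) $s_{p,q}s_{m,r} = s_{m,r}s_{p,q}$ whenever $[p,q]\cap[m,r]=\emptyset$; (j3) $s_{p,q}s_{m,r} = s_{p+q-r,\,p+q-m}\,s_{p,q}$ whenever $[m,r]\subset[p,q]$ (intervals of integers). The leaf number of $s_{p,q}$ is $q-p+1$. For $2\le i\le j\le n$, $J_n^{i,j}$ is the group with generators $s_{p,q}$ for $1\le p<q\le n$ with $i \le q-p+1 \le j$, and as relations all the relations (j1)–(j3) that involve only these generators. -}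

module Defs where

open import Data.Nat using (ℕ; _+_; _∸_; _≤_; _<_; suc)
open import Data.Bool using (Bool; not)
open import Data.List using (List; []; _∷_; _++_; map)
open import Data.Product using (Σ; _×_; _,_; proj₁)
open import Data.Sum using (_⊎_)
open import Relation.Binary.PropositionalEquality using (_≡_)

-- Group presentations ⟨ Gen | Rel ⟩.
-- A letter is (b , g): b = true means g, b = false means g⁻¹.

Letter : Set → Set
Letter G = Bool × G

Word : Set → Set
Word G = List (Letter G)

record Presentation : Set₁ where
  field
    Gen : Set
    Rel : Word Gen → Word Gen → Set
open Presentation public

data _⊢_≈_ (P : Presentation) : Word (Gen P) → Word (Gen P) → Set where
  ≈refl  : ∀ {u} → P ⊢ u ≈ u
  ≈sym   : ∀ {u v} → P ⊢ u ≈ v → P ⊢ v ≈ u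
  ≈trans : ∀ {u v w} → P ⊢ u ≈ v → P ⊢ v ≈ w → P ⊢ u ≈ w
  ≈cong  : ∀ (a b : Word (Gen P)) {u v} → P ⊢ u ≈ v →
           P ⊢ (a ++ u ++ b) ≈ (a ++ v ++ b)
  ≈inv   : ∀ (b : Bool) (g : Gen P) →
           P ⊢ ((b , g) ∷ (not b , g) ∷ []) ≈ []
  ≈rel   : ∀ {u v} → Rel P u v → P ⊢ u ≈ v

mapWord : ∀ {G H : Set} → (G → H) → Word G → Word H
mapWord f = map (λ { (b , g) → (b , f g) })

InducedInjective : (P Q : Presentation) → (Gen P → Gen Q) → Set
InducedInjective P Q f =
  ∀ (u v : Word (Gen P)) → Q ⊢ mapWord f u ≈ mapWord f v → P ⊢ u ≈ v

record JGen (n : ℕ) : Set where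
  constructor s
  field
    p q : ℕ
    1≤p : 1 ≤ p
    p<q : p < q
    q≤n : q ≤ n
open JGen public

leaf : ∀ {n} → JGen n → ℕ
leaf g = suc (q g ∸ p g)

JGenIJ : ℕ → ℕ → ℕ → Set
JGenIJ n i j = Σ (JGen n) (λ g → i ≤ leaf g × leaf g ≤ j)

-- Relations (j1)-(j3) among generators from a set G whose elements are
-- labelled by generators s_{p,q} of J_n via `ι` (all relations involving
-- only generators from G).
data JRel {n : ℕ} {G : Set} (ι : G → JGen n) : Word G → Word G → Set where
  j1 : ∀ (g : G) →
       JRel ι ((Bool.true , g) ∷ (Bool.true , g) ∷ []) []
  j2 : ∀ (g h : G) →
       (q (ι g) < p (ι h) ⊎ q (ι h) < p (ι g)) →
       JRel ι ((Bool.true , g) ∷ (Bool.true , h) ∷ [])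
              ((Bool.true , h) ∷ (Bool.true , g) ∷ [])
  j3 : ∀ (g h k : G) →
       p (ι g) ≤ p (ι h) → q (ι h) ≤ q (ι g) →
       p (ι k) ≡ p (ι g) + q (ι g) ∸ q (ι h) →
       q (ι k) ≡ p (ι g) + q (ι g) ∸ p (ι h) →
       JRel ι ((Bool.true , g) ∷ (Bool.true , h) ∷ [])
              ((Bool.true , k) ∷ (Bool.true , g) ∷ [])

J : ℕ → Presentation
J n = record { Gen = JGen n ; Rel = JRel (λ g → g) }

Jij : ℕ → ℕ → ℕ → Presentation
Jij n i j = record { Gen = JGenIJ n i j ; Rel = JRel proj₁ }

{-# OPTIONS --safe #-}
module Submission where

-- Let D be the right-angled Coxeter group with a generator for each subset of
-- {0, …, n}, two of which commute when the subsets are disjoint or nested.  The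
-- group J_n acts on the reduced words of D modulo commutations: s_{p,q} applies
-- the reversal of [p,q] to every letter and then, if its leaf number lies in
-- [i,j], multiplies by the generator [p,q].  A word in the generators of
-- J_n^{i,j}, applied to the empty word, spells out a word of D, and each
-- commutation or cancellation needed to reduce the latter lifts to one of the
-- relations (j1)–(j3) of J_n^{i,j}.  Hence a word that is trivial in J_n already
-- reduces to the empty word in J_n^{i,j}.

open import Defs
open import Data.Bool using (Bool; true; false; not; _∧_)
open import Data.Bool.Properties using (∧-comm; ∧-identityʳ) renaming (_≟_ to _≟ᵇ_)
open import Data.Empty using (⊥; ⊥-elim)
open import Data.Fin using (Fin; toℕ; fromℕ<)
open import Data.Fin.Properties using (all?; toℕ<n; toℕ-fromℕ<; toℕ-injective)
open import Data.List using (List; []; _∷_; _++_; map)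
open import Data.List.Properties using (map-∘; map-cong; map-id; ++-identityʳ)
open import Data.Nat using (ℕ; suc; _+_; _∸_; _≤_; _<_; _≤?_; s≤s; s≤s⁻¹)
open import Data.Nat.Properties
open import Data.Nat.Tactic.RingSolver using (solve-∀)
open import Data.Product using (∃; ∃₂; _×_; _,_; proj₁; proj₂)
open import Data.Sum using (_⊎_; inj₁; inj₂; swap)
open import Data.Vec using (Vec; lookup; tabulate)
open import Data.Vec.Properties using (lookup∘tabulate; tabulate∘lookup; tabulate-cong; ≡-dec)
open import Function using (_∘_)
open import Function.Bundles using (mk⇔)
open import Relation.Binary using (DecidableEquality)
open import Relation.Binary.PropositionalEquality using (_≡_; _≢_; refl; sym; trans; cong; cong₂; subst; subst₂; module ≡-Reasoning)
open import Relation.Nullary using (¬_; Dec; yes; no; does; contradiction)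
open import Relation.Nullary.Decidable using (_×-dec_; _⊎-dec_; does-⇔; dec-true; dec-false)

-- Right-angled Coxeter groups

module RightAngled
  (L : Set) (_≟_ : DecidableEquality L)
  (C : L → L → Set) (C? : ∀ a b → Dec (C a b)) (C-sym : ∀ {a b} → C a b → C b a)
  where

  -- Removal of an occurrence of a that can be moved to the front of the word.
  data Rem (a : L) : List L → List L → Set where
    here  : ∀ {w} → Rem a (a ∷ w) w
    there : ∀ {x w w′} → a ≢ x → C a x → Rem a w w′ → Rem a (x ∷ w) (x ∷ w′)

  infix 4 _~_
  -- Equality in the partially commutative monoid: letters may trade places, but nothing cancels.
  data _~_ : List L → List L → Set where
    ~refl  : ∀ {w} → w ~ w
    ~trans : ∀ {u v w} → u ~ v → v ~ w → u ~ w
    ~cons  : ∀ {x u v} → u ~ v → x ∷ u ~ x ∷ v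
    ~swap  : ∀ {x y w} → C x y → x ∷ y ∷ w ~ y ∷ x ∷ w

  ~sym : ∀ {u v} → u ~ v → v ~ u
  ~sym ~refl        = ~refl
  ~sym (~trans p q) = ~trans (~sym q) (~sym p)
  ~sym (~cons p)    = ~cons (~sym p)
  ~sym (~swap c)    = ~swap (C-sym c)

  ~-reflexive : ∀ {u v} → u ≡ v → u ~ v
  ~-reflexive refl = ~refl

  ~[]⇒≡[] : ∀ {u v} → u ~ v → v ≡ [] → u ≡ []
  ~[]⇒≡[] ~refl        e  = e
  ~[]⇒≡[] (~trans p q) e  = ~[]⇒≡[] p (~[]⇒≡[] q e)
  ~[]⇒≡[] (~cons _)    ()
  ~[]⇒≡[] (~swap _)    ()

  Removable : L → List L → Set
  Removable a w = ∃ (Rem a w)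

  removable? : ∀ a w → Dec (Removable a w)
  removable? a [] = no λ { (_ , ()) }
  removable? a (x ∷ w) with a ≟ x
  ... | yes refl = yes (w , here)
  ... | no a≢x with C? a x
  ...   | no ¬c = no λ { (_ , here) → a≢x refl ; (_ , there _ c _) → ¬c c }
  ...   | yes c with removable? a w
  ...     | yes (w′ , r) = yes (x ∷ w′ , there a≢x c r)
  ...     | no ¬r = no λ { (_ , here) → a≢x refl ; (_ , there _ _ r) → ¬r (_ , r) }

  -- The condition `a ≢ x` in `there` singles out the first occurrence of `a`; where `C a a` holds,
  -- commutation alone would let one copy pass another.
  Rem-unique : ∀ {a w u v} → Rem a w u → Rem a w v → u ≡ v
  Rem-unique here            here            = refl
  Rem-unique here            (there a≢a _ _) = contradiction refl a≢a
  Rem-unique (there a≢a _ _) here            = contradiction refl a≢a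
  Rem-unique (there _ _ r)   (there _ _ r₁)   = cong (_ ∷_) (Rem-unique r r₁)

  Rem⇒~ : ∀ {a w w′} → Rem a w w′ → w ~ a ∷ w′
  Rem⇒~ here          = ~refl
  Rem⇒~ (there _ c r) = ~trans (~cons (Rem⇒~ r)) (~swap (C-sym c))

  Rem-resp-~ : ∀ {a w v w′} → w ~ v → Rem a w w′ → ∃ λ v′ → Rem a v v′ × w′ ~ v′
  Rem-resp-~ ~refl r = _ , r , ~refl
  Rem-resp-~ (~trans p q) r with Rem-resp-~ p r
  ... | _ , r₁ , e₁ with Rem-resp-~ q r₁
  ...   | _ , r₂ , e₂ = _ , r₂ , ~trans e₁ e₂
  Rem-resp-~ (~cons p) here = _ , here , p
  Rem-resp-~ (~cons p) (there a≢x c r) with Rem-resp-~ p r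
  ... | _ , r₁ , e₁ = _ , there a≢x c r₁ , ~cons e₁
  Rem-resp-~ {a} (~swap {y = y} c) here with a ≟ y
  -- The swapped letters are equal, so both sides are the same word.
  ... | yes refl = _ , here , ~refl
  ... | no a≢y   = _ , there a≢y c here , ~refl
  Rem-resp-~ (~swap c) (there _ _ here) = _ , here , ~refl
  Rem-resp-~ (~swap c) (there a≢x c₁ (there a≢y c₂ r)) =
    _ , there a≢y c₂ (there a≢x c₁ r) , ~swap c

  Rem-tail : ∀ {a x w v} → a ≢ x → Rem a (x ∷ w) v → ∃ λ v′ → Rem a w v′ × v ≡ x ∷ v′
  Rem-tail a≢a here          = contradiction refl a≢a
  Rem-tail _   (there _ _ r) = _ , r , refl

  Rem-∷ : ∀ {a x w v} → Rem a (x ∷ w) v →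
          (a ≡ x × v ≡ w) ⊎ ∃ λ v′ → C a x × Rem a w v′ × v ≡ x ∷ v′
  Rem-∷ here          = inj₁ (refl , refl)
  Rem-∷ (there _ c r) = inj₂ (_ , c , r , refl)

  -- Reduced words and left multiplication

  data Reduced : List L → Set where
    []  : Reduced []
    _∷_ : ∀ {x w} → ¬ Removable x w → Reduced w → Reduced (x ∷ w)

  -- With `b` put back in front of `w′`, the removal of `a` passes over it, and `b ∷ w′` is `w` up
  -- to commutation.
  Rem-after-Rem : ∀ {a b w w′} → a ≢ b → C a b → Rem b w w′ → Removable a w′ → Removable a w
  Rem-after-Rem a≢b c r (_ , r₁) with Rem-resp-~ (~sym (Rem⇒~ r)) (there a≢b c r₁)
  ... | _ , t , _ = _ , t

  Rem-reduced : ∀ {a w w′} → Reduced w → Rem a w w′ → Reduced w′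
  Rem-reduced (_ ∷ red)  here            = red
  Rem-reduced (¬r ∷ red) (there a≢x c r) =
    (λ r₁ → ¬r (Rem-after-Rem (a≢x ∘ sym) (C-sym c) r r₁)) ∷ Rem-reduced red r

  Rem-once : ∀ {a w w′} → Reduced w → Rem a w w′ → ¬ Removable a w′
  Rem-once (¬r ∷ _)  here            = ¬r
  Rem-once (_ ∷ red) (there a≢x _ r) (_ , r₁) with Rem-tail a≢x r₁
  ... | _ , s′ , _ = Rem-once red r (_ , s′)

  -- Left multiplication by the generator `a` in the Coxeter group, meant for reduced words.
  push : L → List L → List L
  push a w with removable? a w
  ... | yes (w′ , _) = w′
  ... | no _         = a ∷ w

  push-Rem : ∀ {a w w′} → Rem a w w′ → push a w ≡ w′
  push-Rem {a} {w} r with removable? a w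
  ... | yes (_ , r₁) = Rem-unique r₁ r
  ... | no ¬r       = contradiction (_ , r) ¬r

  push-¬Rem : ∀ {a w} → ¬ Removable a w → push a w ≡ a ∷ w
  push-¬Rem {a} {w} ¬r with removable? a w
  ... | yes r = contradiction r ¬r
  ... | no _  = refl

  push-reduced : ∀ a {w} → Reduced w → Reduced (push a w)
  push-reduced a {w} red with removable? a w
  ... | yes (_ , r) = Rem-reduced red r
  ... | no ¬r       = ¬r ∷ red

  push-cong : ∀ a {w v} → w ~ v → push a w ~ push a v
  push-cong a {w} {v} p with removable? a w
  ... | yes (_ , r) with Rem-resp-~ p r
  ...   | _ , r₁ , e rewrite push-Rem r₁ = e
  push-cong a {w} {v} p | no ¬r = ~trans (~cons p) (~-reflexive (sym (push-¬Rem ¬s)))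
    where
    ¬s : ¬ Removable a v
    ¬s (_ , r₁) with Rem-resp-~ (~sym p) r₁
    ... | _ , r , _ = ¬r (_ , r)

  push-involutive : ∀ a {w} → Reduced w → push a (push a w) ~ w
  push-involutive a {w} red with removable? a w
  ... | yes (_ , r) rewrite push-¬Rem (Rem-once red r) = ~sym (Rem⇒~ r)
  ... | no _        rewrite push-Rem (here {a} {w})    = ~refl

  -- For distinct commuting letters, multiplying by one does not affect whether the other cancels.
  push-comm : ∀ {a b} → C a b → ∀ w → push a (push b w) ~ push b (push a w)
  push-comm {a} {b} c w with a ≟ b
  ... | yes refl = ~refl
  ... | no a≢b with removable? a w | removable? b w
  ...   | no ¬r | no ¬s
    rewrite push-¬Rem {a} {b ∷ w} (λ { (_ , t) → ¬r (_ , proj₁ (proj₂ (Rem-tail a≢b t))) })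
          | push-¬Rem {b} {a ∷ w} (λ { (_ , t) → ¬s (_ , proj₁ (proj₂ (Rem-tail (a≢b ∘ sym) t))) })
    = ~swap c
  ...   | yes (_ , r) | no ¬s
    rewrite push-Rem (there a≢b c r)
          | push-¬Rem (¬s ∘ Rem-after-Rem (a≢b ∘ sym) (C-sym c) r)
    = ~refl
  ...   | no ¬r | yes (_ , r₁)
    rewrite push-Rem (there (a≢b ∘ sym) (C-sym c) r₁)
          | push-¬Rem (¬r ∘ Rem-after-Rem a≢b c r₁)
    = ~refl
  -- Both letters cancel. Moving `a` to the front of `w` shows that `b` can still be removed after
  -- `a`; moving back shows the same for `a` after `b`, with the same remainder up to commutation.
  ...   | yes (_ , r) | yes (_ , r₁) with Rem-resp-~ (Rem⇒~ r) r₁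
  ...     | _ , t , e with Rem-tail (a≢b ∘ sym) t
  ...       | _ , t′ , refl with Rem-resp-~ (~sym e) here
  ...         | _ , r′ , e′ rewrite push-Rem t′ | push-Rem r′ = ~sym e′

  -- Involutive automorphisms of the commutation relation

  module Equivariance
    (f : L → L) (f-inv : ∀ a → f (f a) ≡ a) (f-C : ∀ {a b} → C a b → C (f a) (f b))
    where

    f-injective : ∀ {a b} → f a ≡ f b → a ≡ b
    f-injective {a} {b} e = trans (sym (f-inv a)) (trans (cong f e) (f-inv b))

    map-inv : ∀ w → map f (map f w) ≡ w
    map-inv w = trans (sym (map-∘ w)) (trans (map-cong f-inv w) (map-id w))

    Rem-map : ∀ {a w w′} → Rem a w w′ → Rem (f a) (map f w) (map f w′)
    Rem-map here            = here
    Rem-map (there a≢x c r) = there (a≢x ∘ f-injective) (f-C c) (Rem-map r)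

    -- As `f` is its own inverse, applying it once more undoes the relabelling.
    Removable-unmap : ∀ {a w} → Removable (f a) (map f w) → Removable a w
    Removable-unmap {a} {w} (_ , r) = _ , subst₂ (λ b v → Rem b v (map f _)) (f-inv a) (map-inv w) (Rem-map r)

    map-~ : ∀ {w v} → w ~ v → map f w ~ map f v
    map-~ ~refl        = ~refl
    map-~ (~trans p q) = ~trans (map-~ p) (map-~ q)
    map-~ (~cons p)    = ~cons (map-~ p)
    map-~ (~swap c)    = ~swap (f-C c)

    map-reduced : ∀ {w} → Reduced w → Reduced (map f w)
    map-reduced []         = []
    map-reduced (¬r ∷ red) = (¬r ∘ Removable-unmap) ∷ map-reduced red

    map-push : ∀ a w → map f (push a w) ≡ push (f a) (map f w)
    map-push a w with removable? a w
    ... | yes (_ , r) = sym (push-Rem (Rem-map r))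
    ... | no ¬r       = sym (push-¬Rem (¬r ∘ Removable-unmap))

-- Reversals of intervals

module _ {n : ℕ} where

  infix 4 _∈_ _∈?_
  _∈_ : ℕ → JGen n → Set
  x ∈ g = p g ≤ x × x ≤ q g

  _∈?_ : ∀ x g → Dec (x ∈ g)
  x ∈? g = (p g ≤? x) ×-dec (x ≤? q g)

  Σpq : JGen n → ℕ
  Σpq g = p g + q g

  rev : JGen n → ℕ → ℕ
  rev g x with x ∈? g
  ... | yes _ = Σpq g ∸ x
  ... | no _  = x

  rev-in : ∀ g {x} → x ∈ g → rev g x + x ≡ Σpq g
  rev-in g {x} x∈g with x ∈? g
  ... | yes _  = m∸n+n≡m (m≤n⇒m≤o+n (p g) (proj₂ x∈g))
  ... | no x∉g = contradiction x∈g x∉g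

  rev-out : ∀ g {x} → ¬ x ∈ g → rev g x ≡ x
  rev-out g {x} x∉g with x ∈? g
  ... | yes x∈g = contradiction x∈g x∉g
  ... | no _    = refl

  rev-∈ : ∀ g {x} → x ∈ g → rev g x ∈ g
  rev-∈ g {x} x∈g@(p≤x , x≤q) =
    +-cancelʳ-≤ (q g) _ _ (subst (_≤ rev g x + q g) (rev-in g x∈g) (+-monoʳ-≤ (rev g x) x≤q)) ,
    +-cancelˡ-≤ (p g) _ _ (subst₂ _≤_ (+-comm (rev g x) (p g)) (rev-in g x∈g) (+-monoʳ-≤ (rev g x) p≤x))

  rev-inv : ∀ g x → rev g (rev g x) ≡ x
  rev-inv g x = aux (x ∈? g)
    where
    aux : Dec (x ∈ g) → rev g (rev g x) ≡ x
    aux (no x∉g)  = trans (cong (rev g) (rev-out g x∉g)) (rev-out g x∉g)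
    aux (yes x∈g) = +-cancelʳ-≡ (rev g x) _ _
      (trans (rev-in g (rev-∈ g x∈g)) (trans (sym (rev-in g x∈g)) (+-comm (rev g x) x)))

  rev-≤n : ∀ g {x} → x ≤ n → rev g x ≤ n
  rev-≤n g {x} x≤n = aux (x ∈? g)
    where
    aux : Dec (x ∈ g) → rev g x ≤ n
    aux (no x∉g)  = subst (_≤ n) (sym (rev-out g x∉g)) x≤n
    aux (yes x∈g) = ≤-trans (proj₂ (rev-∈ g x∈g)) (q≤n g)

  Disjoint : JGen n → JGen n → Set
  Disjoint g h = q g < p h ⊎ q h < p g

  disjoint-∉ : ∀ {g h x} → Disjoint g h → x ∈ g → ¬ x ∈ h
  disjoint-∉ (inj₁ lt) (_ , x≤q) (p≤x , _) = <⇒≱ lt (≤-trans p≤x x≤q)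
  disjoint-∉ (inj₂ lt) (p≤x , _) (_ , x≤q) = <⇒≱ lt (≤-trans p≤x x≤q)

  infix 4 _⊑_
  _⊑_ : JGen n → JGen n → Set
  h ⊑ g = p g ≤ p h × q h ≤ q g

  ⊑-∈ : ∀ {h g x} → h ⊑ g → x ∈ h → x ∈ g
  ⊑-∈ (p≤ , ≤q) (p≤x , x≤q) = ≤-trans p≤ p≤x , ≤-trans x≤q ≤q

  -- The reversal of g carries the subinterval h to k.  Both equations are
  -- stated as sums, to avoid truncated subtraction.
  record Mirror (g h k : JGen n) : Set where
    constructor mirror
    field
      h⊑g : h ⊑ g
      lo  : p k + q h ≡ Σpq g
      hi  : q k + p h ≡ Σpq g
  open Mirror

  mirror-sym : ∀ {g h k} → Mirror g h k → Mirror g k h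
  mirror-sym {g} {h} {k} (mirror (p≤ , ≤q) lo hi) = mirror
    ( +-cancelʳ-≤ (q h) _ _ (subst (p g + q h ≤_) (sym lo) (+-monoʳ-≤ (p g) ≤q))
    , +-cancelʳ-≤ (p h) _ _
        (subst₂ _≤_ (sym hi) (+-comm (p h) (q g)) (+-monoˡ-≤ (q g) p≤)))
    (trans (+-comm (p h) (q k)) hi)
    (trans (+-comm (q h) (p k)) lo)

  -- Subtracting `p k + p h` from the common value of `lo` and `hi` leaves the two lengths.
  mirror-leaf : ∀ {g h k} → Mirror g h k → leaf h ≡ leaf k
  mirror-leaf {g} {h} {k} m = cong suc (begin
    q h ∸ p h                  ≡⟨ [m+n]∸[m+o]≡n∸o (p k) (q h) (p h) ⟨
    (p k + q h) ∸ (p k + p h)  ≡⟨ cong (_∸ (p k + p h)) (trans (lo m) (sym (hi m))) ⟩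
    (q k + p h) ∸ (p k + p h)  ≡⟨ cong₂ _∸_ (+-comm (q k) (p h)) (+-comm (p k) (p h)) ⟩
    (p h + q k) ∸ (p h + p k)  ≡⟨ [m+n]∸[m+o]≡n∸o (p h) (q k) (p k) ⟩
    q k ∸ p k                  ∎)
    where open ≡-Reasoning

  mirror-∸ : ∀ {g h k } → p g ≤ p h → q h ≤ q g →
             p k ≡ Σpq g ∸ q h → q k ≡ Σpq g ∸ p h → Mirror g h k
  mirror-∸ {g} {h} p≤ ≤q e e′ = mirror (p≤ , ≤q)
    (trans (cong (_+ q h) e) (m∸n+n≡m q≤Σ))
    (trans (cong (_+ p h) e′) (m∸n+n≡m (≤-trans (<⇒≤ (p<q h)) q≤Σ)))
    where
    q≤Σ : q h ≤ Σpq g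
    q≤Σ = m≤n⇒m≤o+n (p g) ≤q

  reflect : ∀ g h → h ⊑ g → ∃ (Mirror g h)
  reflect g h (p≤ , ≤q) = k , m
    where
    S : ℕ
    S = Σpq g
    pg≤ : p g ≤ S ∸ q h
    pg≤ = subst (_≤ S ∸ q h) (m+n∸n≡m (p g) (q g)) (∸-monoʳ-≤ S ≤q)
    ≤qg : S ∸ p h ≤ q g
    ≤qg = subst (S ∸ p h ≤_) (m+n∸m≡n (p g) (q g)) (∸-monoʳ-≤ S p≤)
    k : JGen n
    -- Reversal exchanges the endpoints, so `q h` gives the lower one.
    k = s (S ∸ q h) (S ∸ p h) (≤-trans (1≤p g) pg≤) (∸-monoʳ-< (p<q h) (m≤n⇒m≤o+n (p g) ≤q)) (≤-trans ≤qg (q≤n g))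
    m : Mirror g h k
    m = mirror-∸ p≤ ≤q refl refl

  rev-mirror : ∀ {g h k x} → Mirror g h k → x ∈ h → rev g x ∈ k
  rev-mirror {g} {h} {k} {x} m x∈h@(p≤x , x≤q) =
    +-cancelʳ-≤ x _ _ (subst (p k + x ≤_) (trans (lo m) (sym e)) (+-monoʳ-≤ (p k) x≤q)) ,
    +-cancelʳ-≤ (p h) _ _ (subst (rev g x + p h ≤_) (trans e (sym (hi m))) (+-monoʳ-≤ (rev g x) p≤x))
    where
    e : rev g x + x ≡ Σpq g
    e = rev-in g (⊑-∈ {h} {g} (h⊑g m) x∈h)

  -- Outside `k` both sides are `rev g x`: `rev k` fixes `x`, and `rev g x` is not in `h`, because
  -- `rev g` would carry it back into `k`.
  rev-conj : ∀ g h k → (∀ {x} → x ∈ h → rev g x ∈ k) →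
             (∀ {x} → x ∈ k → rev h (rev g x) ≡ rev g (rev k x)) →
             ∀ x → rev h (rev g x) ≡ rev g (rev k x)
  rev-conj g h k to on-k x = aux (x ∈? k)
    where
    aux : Dec (x ∈ k) → rev h (rev g x) ≡ rev g (rev k x)
    aux (yes x∈k) = on-k x∈k
    aux (no x∉k)  =
      trans (rev-out h (λ r → x∉k (subst (_∈ k) (rev-inv g x) (to r))))
            (cong (rev g) (sym (rev-out k x∉k)))

  rev-conj-mirror : ∀ {g h k} → Mirror g h k → ∀ x → rev h (rev g x) ≡ rev g (rev k x)
  rev-conj-mirror {g} {h} {k} m = rev-conj g h k (rev-mirror m) on-k
    where
    m′ : Mirror g k h
    m′ = mirror-sym m
    on-k : ∀ {x} → x ∈ k → rev h (rev g x) ≡ rev g (rev k x)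
    -- The sums `b + a` and `c + x` are those of `h` and `k`, which together make twice the sum of
    -- `g`; so do `d + c` and `a + x`.
    on-k {x} x∈k = +-cancelʳ-≡ (a + (c + x)) b d (begin
      b + (a + (c + x))                    ≡⟨ +-assoc b a (c + x) ⟨
      (b + a) + (c + x)                    ≡⟨ cong₂ _+_ (rev-in h (rev-mirror m′ x∈k)) (rev-in k x∈k) ⟩
      (p h + q h) + (p k + q k)            ≡⟨ shuffle₁ (p h) (q h) (p k) (q k) ⟩
      (p k + q h) + (q k + p h)            ≡⟨ cong₂ _+_ (lo m) (hi m) ⟩
      Σpq g + Σpq g                        ≡⟨ cong₂ _+_ (rev-in g (⊑-∈ {k} {g} (h⊑g m′) (rev-∈ k x∈k))) (rev-in g (⊑-∈ {k} {g} (h⊑g m′) x∈k)) ⟨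
      (d + c) + (a + x)                    ≡⟨ shuffle₂ a c d x ⟩
      d + (a + (c + x))                    ∎)
      where
      open ≡-Reasoning
      a b c d : ℕ
      a = rev g x
      b = rev h a
      c = rev k x
      d = rev g c
      shuffle₁ : ∀ a b c d → (a + b) + (c + d) ≡ (c + b) + (d + a)
      shuffle₁ = solve-∀
      shuffle₂ : ∀ a c d x → (d + c) + (a + x) ≡ d + (a + (c + x))
      shuffle₂ = solve-∀

  rev-disjoint : ∀ {g h x} → Disjoint g h → x ∈ h → rev g x ≡ x
  rev-disjoint {g} {h} d x∈h = rev-out g (λ x∈g → disjoint-∉ {g} {h} d x∈g x∈h)

  rev-disjoint-∈ : ∀ {g h x} → Disjoint g h → x ∈ h → rev g x ∈ h
  rev-disjoint-∈ {g} {h} d x∈h = subst (_∈ h) (sym (rev-disjoint {g} {h} d x∈h)) x∈h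

  rev-conj-disjoint : ∀ {g h} → Disjoint g h → ∀ x → rev h (rev g x) ≡ rev g (rev h x)
  rev-conj-disjoint {g} {h} d = rev-conj g h h (rev-disjoint-∈ {g} {h} d) λ x∈h →
    trans (cong (rev h) (rev-disjoint {g} {h} d x∈h)) (sym (rev-disjoint {g} {h} d (rev-∈ h x∈h)))

  rev-⊑-∈ : ∀ {g h x} → g ⊑ h → x ∈ h → rev g x ∈ h
  rev-⊑-∈ {g} {h} {x} g⊑h x∈h = aux (x ∈? g)
    where
    aux : Dec (x ∈ g) → rev g x ∈ h
    aux (no x∉g)  = subst (_∈ h) (sym (rev-out g x∉g)) x∈h
    aux (yes x∈g) = ⊑-∈ {g} {h} g⊑h (rev-∈ g x∈g)

  -- Positions run over 0, ..., n, so that each is its own index; 0 lies in no interval and is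
  -- fixed.
  revF : JGen n → Fin (suc n) → Fin (suc n)
  revF g i = fromℕ< (s≤s (rev-≤n g (s≤s⁻¹ (toℕ<n i))))

  toℕ-revF : ∀ g i → toℕ (revF g i) ≡ rev g (toℕ i)
  toℕ-revF g i = toℕ-fromℕ< _

  toℕ-revF² : ∀ g h i → toℕ (revF g (revF h i)) ≡ rev g (rev h (toℕ i))
  toℕ-revF² g h i = trans (toℕ-revF g (revF h i)) (cong (rev g) (toℕ-revF h i))

-- The twisted action on subsets

  -- All subsets serve as letters because a reversal can turn a partially overlapping interval into
  -- a set that is not an interval. Bit vectors make their equality decidable and pointwise.
  Subset : Set
  Subset = Vec Bool (suc n)

  ⟦_⟧ : JGen n → Subset
  ⟦ g ⟧ = tabulate λ i → does (toℕ i ∈? g)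

  -- Disjoint or nested, expressed by the intersection being empty, `A` or `B`: pointwise equations
  -- survive any permutation of positions.
  Comm : Subset → Subset → Set
  Comm A B = (∀ i → lookup A i ∧ lookup B i ≡ false)
           ⊎ (∀ i → lookup A i ∧ lookup B i ≡ lookup A i)
           ⊎ (∀ i → lookup A i ∧ lookup B i ≡ lookup B i)

  Comm? : ∀ A B → Dec (Comm A B)
  Comm? A B = all? (λ i → _ ≟ᵇ _) ⊎-dec (all? (λ i → _ ≟ᵇ _) ⊎-dec all? (λ i → _ ≟ᵇ _))

  Comm-sym : ∀ {A B} → Comm A B → Comm B A
  Comm-sym {A} {B} (inj₁ d)        = inj₁ λ i → trans (∧-comm (lookup B i) _) (d i)
  Comm-sym {A} {B} (inj₂ (inj₁ d)) = inj₂ (inj₂ λ i → trans (∧-comm (lookup B i) _) (d i))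
  Comm-sym {A} {B} (inj₂ (inj₂ d)) = inj₂ (inj₁ λ i → trans (∧-comm (lookup B i) _) (d i))

  act : JGen n → Subset → Subset
  act g A = tabulate (lookup A ∘ revF g)

  lookup-act : ∀ g A i → lookup (act g A) i ≡ lookup A (revF g i)
  lookup-act g A = lookup∘tabulate (lookup A ∘ revF g)

  lookup-⟦⟧ : ∀ g i → lookup ⟦ g ⟧ i ≡ does (toℕ i ∈? g)
  lookup-⟦⟧ g = lookup∘tabulate _

  act-inv : ∀ g A → act g (act g A) ≡ A
  act-inv g A = trans (tabulate-cong λ i → trans (lookup-act g A (revF g i)) (cong (lookup A) (inv i)))
                      (tabulate∘lookup A)
    where
    inv : ∀ i → revF g (revF g i) ≡ i
    inv i = toℕ-injective (trans (toℕ-revF² g g i) (rev-inv g (toℕ i)))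

  -- `act` pulls back along the reversal, which reverses composition: `act g (act h A)` reads `A` at
  -- `rev h (rev g x)`.
  act-conj : ∀ {g h k} → (∀ x → rev h (rev g x) ≡ rev g (rev k x)) →
             ∀ A → act g (act h A) ≡ act k (act g A)
  act-conj {g} {h} {k} e A = tabulate-cong λ i → begin
    lookup (act h A) (revF g i)  ≡⟨ lookup-act h A (revF g i) ⟩
    lookup A (revF h (revF g i)) ≡⟨ cong (lookup A) (toℕ-injective (trans (toℕ-revF² h g i) (trans (e (toℕ i)) (sym (toℕ-revF² g k i))))) ⟩
    lookup A (revF g (revF k i)) ≡⟨ lookup-act g A (revF k i) ⟨
    lookup (act g A) (revF k i)  ∎
    where open ≡-Reasoning

  act-Comm : ∀ g {A B} → Comm A B → Comm (act g A) (act g B)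
  act-Comm g {A} {B} c with ∧-act ← (λ i → cong₂ _∧_ (lookup-act g A i) (lookup-act g B i)) | c
  ... | inj₁ d        = inj₁ λ i → trans (∧-act i) (d _)
  ... | inj₂ (inj₁ d) = inj₂ (inj₁ λ i → trans (∧-act i) (trans (d _) (sym (lookup-act g A i))))
  ... | inj₂ (inj₂ d) = inj₂ (inj₂ λ i → trans (∧-act i) (trans (d _) (sym (lookup-act g B i))))

  act-⟦⟧ : ∀ {g h k} → (∀ {x} → x ∈ h → rev g x ∈ k) → (∀ {x} → x ∈ k → rev g x ∈ h) →
           act g ⟦ h ⟧ ≡ ⟦ k ⟧
  act-⟦⟧ {g} {h} {k} to from = tabulate-cong λ i → trans (lookup-⟦⟧ h (revF g i))
    (does-⇔ (mk⇔ (λ r → subst (_∈ k) (rev-inv g (toℕ i)) (to (subst (_∈ h) (toℕ-revF g i) r)))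
                 (λ r → subst (_∈ h) (sym (toℕ-revF g i)) (from r)))
            (toℕ (revF g i) ∈? h) (toℕ i ∈? k))

  -- Commutation of intervals and the cactus relations

  Comm-disjoint : ∀ {g h} → Disjoint g h → Comm ⟦ g ⟧ ⟦ h ⟧
  Comm-disjoint {g} {h} d = inj₁ λ i → trans (cong₂ _∧_ (lookup-⟦⟧ g i) (lookup-⟦⟧ h i))
    (dec-false ((toℕ i ∈? g) ×-dec (toℕ i ∈? h)) λ (a , b) → disjoint-∉ {g} {h} d a b)

  Comm-⊑ : ∀ {g h} → h ⊑ g → Comm ⟦ g ⟧ ⟦ h ⟧
  Comm-⊑ {g} {h} h⊑g = inj₂ (inj₂ λ i → trans (cong₂ _∧_ (lookup-⟦⟧ g i) (lookup-⟦⟧ h i))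
    (trans (does-⇔ (mk⇔ proj₂ λ b → ⊑-∈ {h} {g} h⊑g b , b) ((toℕ i ∈? g) ×-dec (toℕ i ∈? h)) (toℕ i ∈? h))
           (sym (lookup-⟦⟧ h i))))

  ∈-⟦⟧ : ∀ {g x} → x ∈ g → ∃ λ i → toℕ i ≡ x × lookup ⟦ g ⟧ i ≡ true
  ∈-⟦⟧ {g} {x} x∈g = i , e , trans (lookup-⟦⟧ g i) (dec-true (toℕ i ∈? g) (subst (_∈ g) (sym e) x∈g))
    where
    i : Fin (suc n)
    i = fromℕ< (s≤s (≤-trans (proj₂ x∈g) (q≤n g)))
    e : toℕ i ≡ x
    e = toℕ-fromℕ< _

  ⟦⟧-∈ : ∀ {g i} → lookup ⟦ g ⟧ i ≡ true → toℕ i ∈ g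
  ⟦⟧-∈ {g} {i} e with toℕ i ∈? g
  ... | yes r = r
  ... | no ¬r with () ← trans (sym (dec-false (toℕ i ∈? g) ¬r)) (trans (sym (lookup-⟦⟧ g i)) e)

  p∈ : ∀ g → p g ∈ g
  p∈ g = ≤-refl , <⇒≤ (p<q g)

  q∈ : ∀ g → q g ∈ g
  q∈ g = <⇒≤ (p<q g) , ≤-refl

  ∈⇒⊑ : ∀ {h g} → (∀ {x} → x ∈ h → x ∈ g) → h ⊑ g
  ∈⇒⊑ {h} f = proj₁ (f (p∈ h)) , proj₂ (f (q∈ h))

  ⟦⟧-⊑ : ∀ {h g} → (∀ i → lookup ⟦ h ⟧ i ≡ true → lookup ⟦ g ⟧ i ≡ true) → h ⊑ g
  ⟦⟧-⊑ {h} {g} f = ∈⇒⊑ {h} {g} λ x∈h → let i , e , t = ∈-⟦⟧ {h} x∈h in subst (_∈ g) e (⟦⟧-∈ {g} {i} (f i t))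

  JGen-≡ : ∀ {g h : JGen n} → p g ≡ p h → q g ≡ q h → g ≡ h
  JGen-≡ {s p q a b c} {s p q a′ b′ c′} refl refl
    rewrite ≤-irrelevant a a′ | ≤-irrelevant b b′ | ≤-irrelevant c c′ = refl

  ⟦⟧-injective : ∀ {g h} → ⟦ g ⟧ ≡ ⟦ h ⟧ → g ≡ h
  ⟦⟧-injective {g} {h} e
    with ⟦⟧-⊑ {g} {h} (λ i → trans (cong (λ A → lookup A i) (sym e)))
       | ⟦⟧-⊑ {h} {g} (λ i → trans (cong (λ A → lookup A i) e))
  ... | a , b | c , d = JGen-≡ (≤-antisym c a) (≤-antisym b d)

  -- This turns a commutation in D between two intervals back into the hypothesis of (j2) or (j3).
  Comm-⟦⟧ : ∀ {g h} → Comm ⟦ g ⟧ ⟦ h ⟧ → Disjoint g h ⊎ g ⊑ h ⊎ h ⊑ g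
  Comm-⟦⟧ {g} {h} (inj₁ d) = inj₁ disj
    where
    meet : ∀ {x} → x ∈ g → x ∈ h → ⊥
    meet x∈g x∈h with ∈-⟦⟧ {g} x∈g | ∈-⟦⟧ {h} x∈h
    ... | i , e , t | j , e′ , t′ with toℕ-injective (trans e (sym e′))
    ... | refl with trans (sym (cong₂ _∧_ t t′)) (d i)
    ... | ()
    disj : Disjoint g h
    disj with q g <? p h | q h <? p g
    ... | yes lt | _      = inj₁ lt
    ... | no _   | yes lt = inj₂ lt
    -- Intervals that are not disjoint share the larger of their left endpoints.
    ... | no a   | no b with ≤-total (p g) (p h)
    ...   | inj₁ le = ⊥-elim (meet {p h} (le , ≮⇒≥ a) (p∈ h))
    ...   | inj₂ le = ⊥-elim (meet {p g} (p∈ g) (le , ≮⇒≥ b))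
  Comm-⟦⟧ {g} {h} (inj₂ (inj₁ d)) =
    inj₂ (inj₁ (⟦⟧-⊑ {g} {h} λ i t → trans (sym (cong (_∧ lookup ⟦ h ⟧ i) t)) (trans (d i) t)))
  Comm-⟦⟧ {g} {h} (inj₂ (inj₂ d)) =
    inj₂ (inj₂ (⟦⟧-⊑ {h} {g} λ i t → trans (sym (trans (cong (lookup ⟦ g ⟧ i ∧_) t) (∧-identityʳ _))) (trans (d i) t)))

  -- What the relations s_g s_h = s_k s_g of types (j2) and (j3) have in common.
  record Exchange (g h k : JGen n) : Set where
    field
      leaf-≡ : leaf h ≡ leaf k
      comm   : Comm ⟦ g ⟧ ⟦ k ⟧
      move   : act g ⟦ h ⟧ ≡ ⟦ k ⟧
      fix    : act k ⟦ g ⟧ ≡ ⟦ g ⟧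
      conj   : ∀ A → act g (act h A) ≡ act k (act g A)
  open Exchange

  disjoint-exchange : ∀ {g h} → Disjoint g h → Exchange g h h
  disjoint-exchange {g} {h} d = record
    { leaf-≡ = refl
    ; comm   = Comm-disjoint {g} {h} d
    ; move   = act-⟦⟧ {g} {h} {h} (rev-disjoint-∈ {g} {h} d) (rev-disjoint-∈ {g} {h} d)
    ; fix    = act-⟦⟧ {h} {g} {g} (rev-disjoint-∈ {h} {g} (swap d)) (rev-disjoint-∈ {h} {g} (swap d))
    ; conj   = act-conj {g} {h} {h} (rev-conj-disjoint {g} {h} d)
    }

  mirror-exchange : ∀ {g h k} → Mirror g h k → Exchange g h k
  mirror-exchange {g} {h} {k} m = record
    { leaf-≡ = mirror-leaf m
    ; comm   = Comm-⊑ {g} {k} k⊑g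
    ; move   = act-⟦⟧ {g} {h} {k} (rev-mirror m) (rev-mirror (mirror-sym m))
    ; fix    = act-⟦⟧ {k} {g} {g} (rev-⊑-∈ {k} {g} k⊑g) (rev-⊑-∈ {k} {g} k⊑g)
    ; conj   = act-conj {g} {h} {k} (rev-conj-mirror m)
    }
    where
    k⊑g : k ⊑ g
    k⊑g = h⊑g (mirror-sym m)

  act-self : ∀ g → act g ⟦ g ⟧ ≡ ⟦ g ⟧
  act-self g = act-⟦⟧ {g} {g} {g} (rev-∈ g) (rev-∈ g)

-- Injectivity

module _ {P : Presentation} where

  ≈-++ˡ : ∀ w {u v} → P ⊢ u ≈ v → P ⊢ (w ++ u) ≈ (w ++ v)
  ≈-++ˡ w {u} {v} e = subst₂ (P ⊢_≈_) (cong (w ++_) (++-identityʳ u)) (cong (w ++_) (++-identityʳ v))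
                             (≈cong w [] e)

  ≈-++ʳ : ∀ {u v} w → P ⊢ u ≈ v → P ⊢ (u ++ w) ≈ (v ++ w)
  ≈-++ʳ w e = ≈cong [] w e

  ≈-cancelˡ : ∀ b g w → P ⊢ ((not b , g) ∷ (b , g) ∷ w) ≈ w
  ≈-cancelˡ true  g w = ≈-++ʳ w (≈inv false g)
  ≈-cancelˡ false g w = ≈-++ʳ w (≈inv true g)

module _ (i j n : ℕ) where

  open RightAngled (Subset {n}) (≡-dec _≟ᵇ_) Comm Comm? (λ {A} {B} → Comm-sym {A = A} {B})
  module E (g : JGen n) = Equivariance (act g) (act-inv g) (λ {A} {B} → act-Comm g {A} {B})
  open Exchange

  -- The action of the cactus group on reduced words

  InRange : ℕ → Set
  InRange l = i ≤ l × l ≤ j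

  inRange? : ∀ l → Dec (InRange l)
  inRange? l = (i ≤? l) ×-dec (l ≤? j)

  pushIf : ℕ → Subset → List Subset → List Subset
  pushIf l A w with inRange? l
  ... | yes _ = push A w
  ... | no _  = w

  pushIf-in : ∀ {l} → InRange l → ∀ A w → pushIf l A w ≡ push A w
  pushIf-in {l} r A w with inRange? l
  ... | yes _ = refl
  ... | no ¬r = contradiction r ¬r

  pushIf-reduced : ∀ l A {w} → Reduced w → Reduced (pushIf l A w)
  pushIf-reduced l A red with inRange? l
  ... | yes _ = push-reduced A red
  ... | no _  = red

  pushIf-cong : ∀ l A {w v} → w ~ v → pushIf l A w ~ pushIf l A v
  pushIf-cong l A e with inRange? l
  ... | yes _ = push-cong A e
  ... | no _  = e

  pushIf-involutive : ∀ l A {w} → Reduced w → pushIf l A (pushIf l A w) ~ w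
  pushIf-involutive l A red with inRange? l
  ... | yes _ = push-involutive A red
  ... | no _  = ~refl

  pushIf-comm : ∀ l m {A B} → Comm A B → ∀ w → pushIf l A (pushIf m B w) ~ pushIf m B (pushIf l A w)
  pushIf-comm l m {A} {B} c w with inRange? l | inRange? m
  ... | yes _ | yes _ = push-comm {A} {B} c w
  ... | yes _ | no _  = ~refl
  ... | no _  | yes _ = ~refl
  ... | no _  | no _  = ~refl

  map-pushIf : ∀ g l A w → map (act g) (pushIf l A w) ≡ pushIf l (act g A) (map (act g) w)
  map-pushIf g l A w with inRange? l
  ... | yes _ = E.map-push g A w
  ... | no _  = refl

  -- The affine action on D of the pair (`⟦ g ⟧`, `act g`) in the semidirect product of D with its
  -- automorphisms; out of range the first component is 1.
  step : JGen n → List Subset → List Subset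
  step g w = pushIf (leaf g) ⟦ g ⟧ (map (act g) w)

  step-reduced : ∀ g {w} → Reduced w → Reduced (step g w)
  step-reduced g red = pushIf-reduced (leaf g) ⟦ g ⟧ (E.map-reduced g red)

  step-cong : ∀ g {w v} → w ~ v → step g w ~ step g v
  step-cong g e = pushIf-cong (leaf g) ⟦ g ⟧ (E.map-~ g e)

  -- Separates the D part of a product from its automorphism part, so that relations can be checked
  -- on each.
  step² : ∀ g h w → step g (step h w) ≡
          pushIf (leaf g) ⟦ g ⟧ (pushIf (leaf h) (act g ⟦ h ⟧) (map (act g) (map (act h) w)))
  step² g h w = cong (pushIf (leaf g) ⟦ g ⟧) (map-pushIf g (leaf h) ⟦ h ⟧ (map (act h) w))

  step-involutive : ∀ g {w} → Reduced w → step g (step g w) ~ w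
  step-involutive g {w} red = ~trans (~-reflexive eq) (pushIf-involutive (leaf g) ⟦ g ⟧ red)
    where
    eq : step g (step g w) ≡ pushIf (leaf g) ⟦ g ⟧ (pushIf (leaf g) ⟦ g ⟧ w)
    eq = trans (step² g g w)
      (cong₂ (λ A v → pushIf (leaf g) ⟦ g ⟧ (pushIf (leaf g) A v)) (act-self g) (E.map-inv g w))

  map-conj : ∀ {g h k l : JGen n} → (∀ A → act g (act h A) ≡ act k (act l A)) →
             ∀ w → map (act g) (map (act h) w) ≡ map (act k) (map (act l) w)
  map-conj e w = trans (sym (map-∘ w)) (trans (map-cong e w) (map-∘ w))

  -- The automorphism parts agree by `conj`. By `move` and `fix` the D parts are `⟦ g ⟧ ⟦ k ⟧` and
  -- `⟦ k ⟧ ⟦ g ⟧`, equal by `comm`; `leaf-≡` makes the range tests for `h` and `k` agree.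
  step-exchange : ∀ {g h k} → Exchange g h k → ∀ w → step g (step h w) ~ step k (step g w)
  step-exchange {g} {h} {k} e w =
    ~trans (~-reflexive eq₁)
      (~trans (pushIf-comm (leaf g) (leaf k) {⟦ g ⟧} {⟦ k ⟧} (comm e) (map (act k) (map (act g) w)))
              (~-reflexive eq₂))
    where
    w′ : List Subset
    w′ = map (act k) (map (act g) w)
    eq₁ : step g (step h w) ≡ pushIf (leaf g) ⟦ g ⟧ (pushIf (leaf k) ⟦ k ⟧ w′)
    eq₁ = trans (step² g h w) (cong (pushIf (leaf g) ⟦ g ⟧)
      (trans (cong (λ l → pushIf l (act g ⟦ h ⟧) (map (act g) (map (act h) w))) (leaf-≡ e))
             (cong₂ (pushIf (leaf k)) (move e) (map-conj {g} {h} {k} {g} (conj e) w))))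
    eq₂ : pushIf (leaf k) ⟦ k ⟧ (pushIf (leaf g) ⟦ g ⟧ w′) ≡ step k (step g w)
    eq₂ = trans (cong (λ A → pushIf (leaf k) ⟦ k ⟧ (pushIf (leaf g) A w′)) (sym (fix e)))
                (sym (step² k g w))

  -- Signs are ignored, since each generator is to act as an involution.
  run : Word (JGen n) → List Subset → List Subset
  run []            x = x
  run ((_ , g) ∷ w) x = step g (run w x)

  run-++ : ∀ u v x → run (u ++ v) x ≡ run u (run v x)
  run-++ []            v x = refl
  run-++ ((_ , g) ∷ u) v x = cong (step g) (run-++ u v x)

  run-reduced : ∀ u {x} → Reduced x → Reduced (run u x)
  run-reduced []            red = red
  run-reduced ((_ , g) ∷ u) red = step-reduced g (run-reduced u red)

  run-cong : ∀ u {x y} → x ~ y → run u x ~ run u y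
  run-cong []            e = e
  run-cong ((_ , g) ∷ u) e = step-cong g (run-cong u e)

  -- Reducedness of `x` is what `step-involutive` asks for; `run-reduced` maintains it under a right
  -- context.
  run-sound : ∀ {u v} → J n ⊢ u ≈ v → ∀ {x} → Reduced x → run u x ~ run v x
  run-sound ≈refl          red = ~refl
  run-sound (≈sym e)       red = ~sym (run-sound e red)
  run-sound (≈trans e e′)  red = ~trans (run-sound e red) (run-sound e′ red)
  run-sound (≈cong a b {u} {v} e) {x} red = subst₂ _~_ (sym (split u)) (sym (split v))
    (run-cong a (run-sound e (run-reduced b red)))
    where
    split : ∀ w → run (a ++ w ++ b) x ≡ run a (run w (run b x))
    split w = trans (run-++ a (w ++ b) x) (cong (run a) (run-++ w b x))
  run-sound (≈inv _ g)     red = step-involutive g red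
  run-sound (≈rel (j1 g))  red = step-involutive g red
  run-sound (≈rel (j2 g h d)) red = step-exchange (disjoint-exchange d) _
  run-sound (≈rel (j3 g h k p≤ ≤q e e′)) red =
    step-exchange (mirror-exchange (mirror-∸ p≤ ≤q e e′)) _

  -- Lifting reductions in D to the truncated group

  G : Set
  G = JGenIJ n i j

  P : Presentation
  P = Jij n i j

  pos : List G → Word G
  pos = map (true ,_)

  -- The word of D spelled out by w, before any cancellation.
  trace : List G → List Subset
  trace []            = []
  trace ((g , _) ∷ w) = ⟦ g ⟧ ∷ map (act g) (trace w)

  G-≡ : ∀ {g h : G} → proj₁ g ≡ proj₁ h → g ≡ h
  G-≡ {g , a , b} {g , a′ , b′} refl rewrite ≤-irrelevant a a′ | ≤-irrelevant b b′ = refl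

  mirror-rel : ∀ {g h k : G} → Mirror (proj₁ g) (proj₁ h) (proj₁ k) →
               P ⊢ pos (g ∷ h ∷ []) ≈ pos (k ∷ g ∷ [])
  mirror-rel {g} {h} {k} (mirror (p≤ , ≤q) lo hi) =
    ≈rel (j3 g h k p≤ ≤q (solve-∸ lo) (solve-∸ hi))
    where
    solve-∸ : ∀ {a b c} → a + b ≡ c → a ≡ c ∸ b
    solve-∸ {a} {b} e = trans (sym (m+n∸n≡m a b)) (cong (_∸ b) e)

  -- Reflection preserves the leaf number, so the mirror image is again a generator of `P`.
  reflectG : ∀ (g : JGen n) (h : G) → proj₁ h ⊑ g → ∃ λ (k : G) → Mirror g (proj₁ h) (proj₁ k)
  reflectG g (h , r) h⊑g with reflect g h h⊑g
  ... | k , m = (k , subst InRange (mirror-leaf m) r) , m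

  -- After `x`, the letter `⟦ g ⟧` is spelled by the image `g′` of `g` under `x`; after `g`, the
  -- letter `⟦ x ⟧` is spelled by the image `y` of `x` under `g`. The lifted relation is (j2) for
  -- disjoint intervals, and otherwise (j3) with the larger interval outside.
  lift-swap : ∀ (x g : G) → Comm ⟦ proj₁ g ⟧ ⟦ proj₁ x ⟧ → ∃₂ λ (g′ y : G) →
    P ⊢ pos (x ∷ g′ ∷ []) ≈ pos (g ∷ y ∷ []) ×
    act (proj₁ x) ⟦ proj₁ g ⟧ ≡ ⟦ proj₁ g′ ⟧ ×
    act (proj₁ g) ⟦ proj₁ y ⟧ ≡ ⟦ proj₁ x ⟧ ×
    (∀ A → act (proj₁ x) (act (proj₁ g′) A) ≡ act (proj₁ g) (act (proj₁ y) A))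
  lift-swap x g c with Comm-⟦⟧ {g = proj₁ g} {proj₁ x} c
  ... | inj₁ d = g , x , ≈rel (j2 x g (swap d)) , move ex , fix ex , conj ex
    where
    ex : Exchange (proj₁ x) (proj₁ g) (proj₁ g)
    ex = disjoint-exchange (swap d)
  ... | inj₂ (inj₁ g⊑x) with reflectG (proj₁ x) g g⊑x
  ...   | g′ , m = g′ , x , mirror-rel {x} {g′} {g} (mirror-sym m) , move (mirror-exchange m) , fix ex , conj ex
    where
    ex : Exchange (proj₁ x) (proj₁ g′) (proj₁ g)
    ex = mirror-exchange (mirror-sym m)
  lift-swap x g c | inj₂ (inj₂ x⊑g) with reflectG (proj₁ g) x x⊑g
  ...   | y , m = g , y , ≈sym (mirror-rel {g} {y} {x} (mirror-sym m)) , fix ex , move ex , (λ A → sym (conj ex A))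
    where
    ex : Exchange (proj₁ g) (proj₁ y) (proj₁ x)
    ex = mirror-exchange (mirror-sym m)

  -- Each letter that `⟦ g ⟧` passes on its way to the front costs one use of `lift-swap`, so `g`
  -- itself factors out of `w` on the left.
  lift-Rem : ∀ (g : G) w {v} → Rem ⟦ proj₁ g ⟧ (trace w) v →
    ∃ λ w′ → P ⊢ pos w ≈ pos (g ∷ w′) × v ≡ map (act (proj₁ g)) (trace w′)
  lift-Rem g [] ()
  lift-Rem g (x ∷ w) r with Rem-∷ r
  ... | inj₁ (e , refl) with G-≡ {g} {x} (⟦⟧-injective e)
  ...   | refl = w , ≈refl , refl
  lift-Rem g (x ∷ w) r | inj₂ (v , c , r′ , refl) with lift-swap x g c
  ... | g′ , y , rel , xg , gy , con
    -- The removal takes place in `map (act x) (trace w)`; a second `act x` brings it back to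
    -- `trace w` and turns `⟦ g ⟧` into `⟦ g′ ⟧`.
    with lift-Rem g′ w (subst₂ (λ A u → Rem A u (map (act (proj₁ x)) v)) xg
                               (E.map-inv (proj₁ x) (trace w)) (E.Rem-map (proj₁ x) r′))
  ...   | w′ , e , eq =
    y ∷ w′ ,
    ≈trans (≈-++ˡ ((true , x) ∷ []) e) (≈-++ʳ (pos w′) rel) ,
    cong₂ _∷_ (sym gy)
      (trans (sym (E.map-inv (proj₁ x) v))
        (trans (cong (map (act (proj₁ x))) eq)
               (map-conj {proj₁ x} {proj₁ g′} {proj₁ g} {proj₁ y} con (trace w′))))

  -- By (j1), the inverse of `g` equals that inverse times `g g`, which is `g`.
  ≈-true : ∀ b (g : G) w → P ⊢ ((b , g) ∷ w) ≈ ((true , g) ∷ w)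
  ≈-true true  g w = ≈refl
  ≈-true false g w = ≈trans (≈-++ˡ ((false , g) ∷ []) (≈sym (≈-++ʳ w (≈rel (j1 g)))))
                            (≈-cancelˡ true g ((true , g) ∷ w))

  -- Every cancellation made by `run` is matched by one in `P`, so the trace of `w′` equals the
  -- result of the run letter by letter.
  normalise : ∀ (w : Word G) → ∃ λ w′ → P ⊢ w ≈ pos w′ × run (mapWord proj₁ w) [] ≡ trace w′
  normalise [] = [] , ≈refl , refl
  normalise ((b , g@(g₀ , rg)) ∷ w) with normalise w
  ... | w′ , e , eq
    with trans (cong (step g₀) eq) (pushIf-in rg ⟦ g₀ ⟧ (map (act g₀) (trace w′)))
       | removable? ⟦ g₀ ⟧ (map (act g₀) (trace w′))
  ... | run≡push | no ¬r =
    g ∷ w′ , ≈trans (≈-true b g w) (≈-++ˡ ((true , g) ∷ []) e) , trans run≡push (push-¬Rem ¬r)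
  ... | run≡push | yes (v , r)
    -- As `act g₀` fixes `⟦ g₀ ⟧`, undoing it makes `⟦ g₀ ⟧` removable from `trace w′`; then `g`
    -- factors out of `w′` and cancels against the new letter by (j1).
    with lift-Rem g w′ (subst₂ (λ A u → Rem A u (map (act g₀) v)) (act-self g₀)
                               (E.map-inv g₀ (trace w′)) (E.Rem-map g₀ r))
  ...   | w″ , e′ , eq′ =
    w″ ,
    ≈trans (≈-true b g w)
      (≈trans (≈-++ˡ ((true , g) ∷ []) (≈trans e e′)) (≈-++ʳ (pos w″) (≈rel (j1 g)))) ,
    trans run≡push (trans (push-Rem r)
      (trans (sym (E.map-inv g₀ v)) (trans (cong (map (act g₀)) eq′) (E.map-inv g₀ (trace w″)))))

  -- The run from the empty word is empty by soundness, hence so is the trace of the normal form;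
  -- `trace` preserves length, so the normal form is empty.
  kernel-trivial : ∀ (w : Word G) → J n ⊢ mapWord proj₁ w ≈ [] → P ⊢ w ≈ []
  kernel-trivial w e with normalise w
  ... | []     , e′ , _  = e′
  ... | _ ∷ _ , _  , eq with trans (sym eq) (~[]⇒≡[] (run-sound e []) refl)
  ...   | ()

  -- The letters of the right-hand word are moved to the left one at a time, as inverses, until the
  -- kernel statement applies.
  injective : InducedInjective P (J n) proj₁
  injective u []            e = kernel-trivial u e
  injective u ((b , g) ∷ v) e =
    ≈trans (≈sym (≈-++ʳ u (≈inv b g)))
      (≈-++ˡ ((b , g) ∷ []) (injective ((not b , g) ∷ u) v
        (≈trans (≈-++ˡ ((not b , proj₁ g) ∷ []) e) (≈-cancelˡ b (proj₁ g) (mapWord proj₁ v)))))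

theoremA : ∀ (i j n : ℕ) → 2 ≤ i → i ≤ j → j ≤ n →
    InducedInjective (Jij n i j) (J n) proj₁
theoremA i j n _ _ _ = injective i j n
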